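{- For every prime power $q$ and every $G\in\mathfrak{g}_3(\mathbb{F}_q)$, the nonlooped vertices of $G$ are pairwise adjacent (they form a clique).
   Context: For a symmetric $n\times n$ matrix $A$, the looped graph corresponding to $A$, $\Gamma(A)$, has vertex set $\{1,\dots,n\}$, an edge $ij$ ($i\neq j$) iff $a_{ij}\neq0$, and a loop at $i$ iff $a_{ii}\ne 0$. Definition of $\mathfrak{g}_k(\mathbb{F}_q)$: let $x_1,\dots,x_m$ be representatives of the classes of nonzero vectors of $\mathbb{F}_q^k$ under the relation $x\sim cx$ ($c\in\mathbb{F}_q$, $c\neq0$), and let $U=[x_1\ \cdots\ x_m]$; $\mathfrak{g}_k(\mathbb{F}_q)$ is the set of isomorphism classes of looped graphs $\Gamma(U^tBU)$ as $B$ ranges over the invertible symmetric $k\times k$ matrices over $\mathbb{F}_q$. -}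

module Defs where

open import Algebra.Bundles using (CommutativeRing)
import Algebra.Definitions as AlgebraDefinitions
import Algebra.Properties.Semiring.Sum as SemiringSum
open import Data.Fin.Base using (Fin)
open import Data.Fin.Properties using (_≟_)
open import Data.Nat.Base using (ℕ; suc; _^_)
open import Data.Nat.Primality using (Prime)
open import Data.Product.Base using (∃; ∃-syntax; _×_; _,_)
open import Data.Vec.Functional using (Vector)
import Data.Vec.Functional.Relation.Binary.Equality.Setoid as VectorEquality
open import Function.Bundles using (Inverse; _↔_; _⇔_)
open import Level using (Level; _⊔_) renaming (suc to lsuc)
open import Relation.Binary.Core using (Rel)
open import Relation.Binary.Definitions using (Symmetric)
open import Relation.Binary.PropositionalEquality as ≡ using (_≡_; _≢_)
import Relation.Binary.Reasoning.Setoid as SetoidReasoning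
open import Relation.Nullary.Decidable using (does)
open import Relation.Nullary.Negation using (¬_)
open import Relation.Unary using (Pred)
open import Data.Bool.Base using (if_then_else_)

IsPrimePower : ℕ → Set
IsPrimePower q = ∃[ p ] ∃[ e ] Prime p × q ≡ p ^ suc e

record FiniteField (q : ℕ) (c ℓ : Level) : Set (lsuc (c ⊔ ℓ)) where
  field
    commutativeRing : CommutativeRing c ℓ

  open CommutativeRing commutativeRing public

  field
    0≉1          : 0# ≉ 1#
    ≉0⇒invertible : ∀ {x} → x ≉ 0# →
                    AlgebraDefinitions.Invertible _≈_ 1# _*_ x
    enumeration  : Inverse setoid (≡.setoid (Fin q))

-- Adj is a symmetric relation that need not be irreflexive: for u ≢ v,
-- Adj u v says that uv is an edge, while Adj u u says that u has a loop.
record LoopedGraph (ℓ : Level) : Set (lsuc ℓ) where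
  field
    order   : ℕ
    Adj     : Rel (Fin order) ℓ
    Adj-sym : Symmetric Adj

  Vertex : Set
  Vertex = Fin order

  Looped : Pred Vertex ℓ
  Looped u = Adj u u

record _≅_ {g h} (G : LoopedGraph g) (H : LoopedGraph h) : Set (g ⊔ h) where
  private
    module G = LoopedGraph G
    module H = LoopedGraph H

  field
    vertices : G.Vertex ↔ H.Vertex

  open Inverse vertices using (to)

  field
    adjacency : ∀ u v → G.Adj u v ⇔ H.Adj (to u) (to v)

module OverField {q : ℕ} {c ℓ : Level} (F : FiniteField q c ℓ) where

  open FiniteField F
  open SemiringSum semiring
    using (sum; sum-cong-≋; ∑-comm; *-distribʳ-sum)
  open VectorEquality setoid using (_≋_)

  𝟎 : ∀ {n} → Vector Carrier n
  𝟎 _ = 0#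

  infixr 7 _•_
  _•_ : ∀ {n} → Carrier → Vector Carrier n → Vector Carrier n
  (a • x) i = a * x i

  infix 4 _∼_
  _∼_ : ∀ {n} → Rel (Vector Carrier n) (c ⊔ ℓ)
  x ∼ y = ∃[ a ] a ≉ 0# × y ≋ a • x

  -- One vector from each ∼-class of nonzero vectors.
  record IsRepresentatives {k m} (x : Fin m → Vector Carrier k) : Set (c ⊔ ℓ) where
    field
      nonzero  : ∀ i → ¬ (x i ≋ 𝟎)
      covers   : ∀ v → ¬ (v ≋ 𝟎) → ∃[ i ] x i ∼ v
      distinct : ∀ {i j} → x i ∼ x j → i ≡ j

  Matrix : ℕ → ℕ → Set c
  Matrix m n = Fin m → Fin n → Carrier

  infix 4 _≈ᴹ_
  _≈ᴹ_ : ∀ {m n} → Rel (Matrix m n) ℓ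
  A ≈ᴹ B = ∀ i j → A i j ≈ B i j

  infixl 7 _*ᴹ_
  _*ᴹ_ : ∀ {l m n} → Matrix l m → Matrix m n → Matrix l n
  (A *ᴹ B) i j = sum (λ r → A i r * B r j)

  infix 8 _ᵀ
  _ᵀ : ∀ {m n} → Matrix m n → Matrix n m
  (A ᵀ) i j = A j i

  1ᴹ : ∀ {n} → Matrix n n
  1ᴹ i j = if does (i ≟ j) then 1# else 0#

  fromColumns : ∀ {k m} → (Fin m → Vector Carrier k) → Matrix k m
  fromColumns x i j = x j i

  IsSymmetric : ∀ {n} → Pred (Matrix n n) ℓ
  IsSymmetric A = A ᵀ ≈ᴹ A

  IsInvertible : ∀ {n} → Pred (Matrix n n) (c ⊔ ℓ)
  IsInvertible = AlgebraDefinitions.Invertible _≈ᴹ_ 1ᴹ _*ᴹ_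

  Γ : ∀ {n} (A : Matrix n n) → IsSymmetric A → LoopedGraph ℓ
  Γ {n} A A-sym = record
    { order   = n
    ; Adj     = λ i j → A i j ≉ 0#
    ; Adj-sym = λ {i} {j} aᵢⱼ≉0 aⱼᵢ≈0 → aᵢⱼ≉0 (trans (A-sym j i) aⱼᵢ≈0)
    }

  congruence-symmetric : ∀ {k m} (U : Matrix k m) (B : Matrix k k) →
                         IsSymmetric B → IsSymmetric (U ᵀ *ᴹ B *ᴹ U)
  congruence-symmetric U B B-sym i j = begin
    sum (λ s → sum (λ r → U r j * B r s) * U s i)
      ≈⟨ sum-cong-≋ (λ s → *-distribʳ-sum (U s i) (λ r → U r j * B r s)) ⟩
    sum (λ s → sum (λ r → U r j * B r s * U s i))
      ≈⟨ ∑-comm (λ s r → U r j * B r s * U s i) ⟩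
    sum (λ r → sum (λ s → U r j * B r s * U s i))
      ≈⟨ sum-cong-≋ (λ r → sum-cong-≋ (λ s → swap r s)) ⟩
    sum (λ r → sum (λ s → U s i * B s r * U r j))
      ≈⟨ sum-cong-≋ (λ r → *-distribʳ-sum (U r j) (λ s → U s i * B s r)) ⟨
    sum (λ r → sum (λ s → U s i * B s r) * U r j) ∎
    where
    open SetoidReasoning setoid
    swap : ∀ r s → U r j * B r s * U s i ≈ U s i * B s r * U r j
    swap r s = begin
      U r j * B r s * U s i    ≈⟨ *-comm _ _ ⟩
      U s i * (U r j * B r s)  ≈⟨ *-congˡ (*-comm _ _) ⟩
      U s i * (B r s * U r j)  ≈⟨ *-congˡ (*-congʳ (B-sym s r)) ⟩
      U s i * (B s r * U r j)  ≈⟨ *-assoc _ _ _ ⟨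
      U s i * B s r * U r j    ∎

-- A looped graph belongs to 𝔤 k F when it is isomorphic to some Γ (Uᵀ B U), so
-- 𝔤 k F is a union of isomorphism classes. A different choice of representatives
-- rescales and permutes the columns of U, which changes Γ (Uᵀ B U) only up to
-- isomorphism; hence U may be existentially quantified.
𝔤 : ∀ {q c ℓ g} (k : ℕ) → FiniteField q c ℓ → Pred (LoopedGraph g) (c ⊔ ℓ ⊔ g)
𝔤 k F G =
  ∃[ m ] ∃ λ (x : Fin m → Vector Carrier k) → IsRepresentatives x ×
  ∃ λ (B : Matrix k k) → IsInvertible B × ∃ λ (B-sym : IsSymmetric B) →
  let U = fromColumns x in
  G ≅ Γ (U ᵀ *ᴹ B *ᴹ U) (congruence-symmetric U B B-sym)
  where
  open FiniteField F using (Carrier)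
  open OverField F

NonloopedClique : ∀ {g} → Pred (LoopedGraph g) g
NonloopedClique G = ∀ u v → u ≢ v → ¬ Looped u → ¬ Looped v → Adj u v
  where open LoopedGraph G

{-# OPTIONS --safe #-}
-- If distinct columns x, y of U were nonlooped and nonadjacent, then xB and yB
-- would both be orthogonal to x and to y. As x and y are not proportional, their
-- cross product is a nonzero vector spanning the orthogonal complement of {x, y},
-- so xB and yB are proportional. B being invertible, x and y are then proportional
-- too, contradicting the choice of one representative per class.
module Submission where

open import Defs
open import Data.Fin.Base using (zero; suc)
open import Data.Fin.Patterns using (0F; 1F; 2F)
open import Data.Fin.Properties using (_≟_; all?; ¬∀⟶∃¬)
open import Data.Nat.Base using (ℕ)
open import Data.Product.Base using (∃-syntax; _,_)
open import Data.Vec.Functional using (Vector)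
open import Function.Base using (_∘_)
open import Function.Bundles using (Equivalence; Injection; Inverse)
open import Function.Properties.Inverse using (Inverse⇒Injection)
open import Level using (Level)
open import Relation.Binary.Definitions using (Decidable)
open import Relation.Nullary.Decidable using (yes; no; decidable-stable; via-injection)
open import Relation.Nullary.Negation using (¬_)
open import Relation.Unary using (_∈_)
import Algebra.Properties.Ring as RingProperties
import Algebra.Properties.Semiring.Sum as SemiringSum
import Algebra.Solver.Ring.NaturalCoefficients.Default as SemiringSolver
import Data.Vec.Functional.Relation.Binary.Equality.Setoid as VectorEquality
import Relation.Binary.Reasoning.Setoid as SetoidReasoning

module LinearAlgebra {q : ℕ} {c ℓ : Level} (F : FiniteField q c ℓ) where

  open FiniteField F
  open OverField F
  open RingProperties ring using (+-cancelʳ; x∙y⁻¹≈ε⇒x≈y)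
  open SemiringSum semiring
  open SemiringSolver commutativeSemiring using (solve; con; _:=_; _:+_; _:*_)
  open VectorEquality setoid using (_≋_)
  open SetoidReasoning setoid

  -- Decidable equality, cancellation and proportionality.

  infix 4 _≈?_
  _≈?_ : Decidable _≈_
  _≈?_ = via-injection (Inverse⇒Injection enumeration) _≟_

  *-cancelˡ-nonzero : ∀ {r} → r ≉ 0# → ∀ {x y} → r * x ≈ r * y → x ≈ y
  *-cancelˡ-nonzero {r} r≉0 {x} {y} rx≈ry with ≉0⇒invertible r≉0
  ... | r⁻¹ , r⁻¹r≈1 , _ = begin
    x              ≈⟨ *-identityˡ x ⟨
    1# * x         ≈⟨ *-congʳ r⁻¹r≈1 ⟨
    r⁻¹ * r * x    ≈⟨ *-assoc _ _ _ ⟩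
    r⁻¹ * (r * x)  ≈⟨ *-congˡ rx≈ry ⟩
    r⁻¹ * (r * y)  ≈⟨ *-assoc _ _ _ ⟨
    r⁻¹ * r * y    ≈⟨ *-congʳ r⁻¹r≈1 ⟩
    1# * y         ≈⟨ *-identityˡ y ⟩
    y              ∎

  nonzeroEntry : ∀ {n} {x : Vector Carrier n} → ¬ (x ≋ 𝟎) → ∃[ i ] x i ≉ 0#
  nonzeroEntry {x = x} = ¬∀⟶∃¬ _ (λ i → x i ≈ 0#) (λ i → x i ≈? 0#)

  infix 4 _∥_
  -- Vanishing of all two-by-two minors: a division-free form of linear dependence. The zero vector
  -- is parallel to everything, whence the nonzero hypotheses below.
  _∥_ : ∀ {n} → Vector Carrier n → Vector Carrier n → Set ℓ
  x ∥ y = ∀ i j → x i * y j ≈ x j * y i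

  ∥⇒∼ : ∀ {n} {x y : Vector Carrier n} →
        ¬ (x ≋ 𝟎) → ¬ (y ≋ 𝟎) → x ∥ y → x ∼ y
  ∥⇒∼ {x = x} {y} x≉𝟎 y≉𝟎 x∥y with nonzeroEntry x≉𝟎
  ... | i , xᵢ≉0 with ≉0⇒invertible xᵢ≉0
  -- As `r` inverts `x i`, the scalar is the quotient of `y i` by `x i`; were it zero, `y` would
  -- vanish.
  ... | r , _ , xᵢr≈1 = r * y i , ryᵢ≉0 , y≋ryᵢ•x
    where
    y≋ryᵢ•x : y ≋ (r * y i) • x
    y≋ryᵢ•x j = *-cancelˡ-nonzero xᵢ≉0 (begin
      x i * y j              ≈⟨ x∥y i j ⟩
      x j * y i              ≈⟨ *-identityˡ _ ⟨
      1# * (x j * y i)       ≈⟨ *-congʳ xᵢr≈1 ⟨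
      x i * r * (x j * y i)  ≈⟨ solve 4 (λ xᵢ r xⱼ yᵢ → xᵢ :* r :* (xⱼ :* yᵢ) :=
                                          xᵢ :* (r :* yᵢ :* xⱼ)) refl _ _ _ _ ⟩
      x i * (r * y i * x j)  ∎)

    ryᵢ≉0 : r * y i ≉ 0#
    ryᵢ≉0 ryᵢ≈0 = y≉𝟎 (λ j → trans (y≋ryᵢ•x j) (trans (*-congʳ ryᵢ≈0) (zeroˡ _)))

  -- After multiplication by a nonzero entry of `z`, each hypothesis lets `z` trade its index with a
  -- factor `a` or `b`; three trades interchange `i` and `j`.
  ∥-common : ∀ {n} {z a b : Vector Carrier n} →
             ¬ (z ≋ 𝟎) → z ∥ a → z ∥ b → a ∥ b
  ∥-common {z = z} {a} {b} z≉𝟎 z∥a z∥b i j with nonzeroEntry z≉𝟎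
  ... | k , zₖ≉0 = *-cancelˡ-nonzero zₖ≉0 (begin
    z k * (a i * b j)  ≈⟨ *-assoc _ _ _ ⟨
    z k * a i * b j    ≈⟨ *-congʳ (z∥a k i) ⟩
    z i * a k * b j    ≈⟨ swap _ _ _ ⟩
    z i * b j * a k    ≈⟨ *-congʳ (z∥b i j) ⟩
    z j * b i * a k    ≈⟨ swap _ _ _ ⟩
    z j * a k * b i    ≈⟨ *-congʳ (z∥a j k) ⟩
    z k * a j * b i    ≈⟨ *-assoc _ _ _ ⟩
    z k * (a j * b i)  ∎)
    where
    swap : ∀ r s t → r * s * t ≈ r * t * s
    swap = solve 3 (λ r s t → r :* s :* t := r :* t :* s) refl

  -- Row vectors and matrices.

  infix 7 _·_
  _·_ : ∀ {n} → Vector Carrier n → Vector Carrier n → Carrier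
  x · y = sum (λ i → x i * y i)

  infixl 7 _⊛_
  -- Bracketed so that `(x i ⊛ B) · x j` is definitionally the entry `i j` of `U ᵀ *ᴹ B *ᴹ U` with
  -- `U = fromColumns x`.
  _⊛_ : ∀ {m n} → Vector Carrier m → Matrix m n → Vector Carrier n
  (x ⊛ B) j = x · (λ i → B i j)

  ⊛-cong : ∀ {m n} {x y : Vector Carrier m} {B C : Matrix m n} →
           x ≋ y → B ≈ᴹ C → x ⊛ B ≋ y ⊛ C
  ⊛-cong x≋y B≈C j = sum-cong-≋ (λ i → *-cong (x≋y i) (B≈C i j))

  ⊛-assoc : ∀ {l m n} (x : Vector Carrier l) (B : Matrix l m) (C : Matrix m n) →
            x ⊛ B ⊛ C ≋ x ⊛ (B *ᴹ C)
  ⊛-assoc x B C j = begin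
    sum (λ s → sum (λ r → x r * B r s) * C s j)
      ≈⟨ sum-cong-≋ (λ s → *-distribʳ-sum (C s j) (λ r → x r * B r s)) ⟩
    sum (λ s → sum (λ r → x r * B r s * C s j))
      ≈⟨ ∑-comm (λ s r → x r * B r s * C s j) ⟩
    sum (λ r → sum (λ s → x r * B r s * C s j))
      ≈⟨ sum-cong-≋ (λ r → sum-cong-≋ (λ s → *-assoc (x r) (B r s) (C s j))) ⟩
    sum (λ r → sum (λ s → x r * (B r s * C s j)))
      ≈⟨ sum-cong-≋ (λ r → *-distribˡ-sum (x r) (λ s → B r s * C s j)) ⟨
    sum (λ r → x r * sum (λ s → B r s * C s j)) ∎

  sum-zero : ∀ {n} {x : Vector Carrier n} → x ≋ 𝟎 → sum x ≈ 0#
  sum-zero {n} x≋𝟎 = trans (sum-cong-≋ x≋𝟎) (sum-replicate-zero n)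

  ⊛-identityʳ : ∀ {n} (x : Vector Carrier n) → x ⊛ 1ᴹ ≋ x
  ⊛-identityʳ x zero = begin
    x 0F * 1# + sum (λ i → x (suc i) * 0#)
      ≈⟨ +-cong (*-identityʳ _) (sum-zero (λ i → zeroʳ (x (suc i)))) ⟩
    x 0F + 0#  ≈⟨ +-identityʳ _ ⟩
    x 0F       ∎
  ⊛-identityʳ x (suc j) = begin
    -- Without its first row and column, `1ᴹ` reduces to the identity matrix of the next smaller
    -- size.
    x 0F * 0# + (x ∘ suc ⊛ 1ᴹ) j  ≈⟨ +-cong (zeroʳ _) (⊛-identityʳ (x ∘ suc) j) ⟩
    0# + x (suc j)                ≈⟨ +-identityˡ _ ⟩
    x (suc j)                     ∎

  𝟎-⊛ : ∀ {m n} (B : Matrix m n) → 𝟎 ⊛ B ≋ 𝟎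
  𝟎-⊛ B j = sum-zero (λ i → zeroˡ (B i j))

  •-⊛ : ∀ {m n} r (x : Vector Carrier m) (B : Matrix m n) →
        (r • x) ⊛ B ≋ r • (x ⊛ B)
  •-⊛ r x B j = trans (sum-cong-≋ (λ i → *-assoc r (x i) (B i j)))
                      (sym (*-distribˡ-sum r (λ i → x i * B i j)))

  ⊛-injective : ∀ {n} (B : Matrix n n) → IsInvertible B →
                ∀ {x y} → x ⊛ B ≋ y ⊛ B → x ≋ y
  ⊛-injective B (C , _ , BC≈1) {x} {y} xB≋yB i = begin
    x i            ≈⟨ undo x ⟨
    (x ⊛ B ⊛ C) i  ≈⟨ ⊛-cong {B = C} xB≋yB (λ _ _ → refl) i ⟩
    (y ⊛ B ⊛ C) i  ≈⟨ undo y ⟩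
    y i            ∎
    where
    undo : ∀ z → (z ⊛ B ⊛ C) i ≈ z i
    undo z = begin
      (z ⊛ B ⊛ C) i     ≈⟨ ⊛-assoc z B C i ⟩
      (z ⊛ (B *ᴹ C)) i  ≈⟨ ⊛-cong {x = z} (λ _ → refl) BC≈1 i ⟩
      (z ⊛ 1ᴹ) i        ≈⟨ ⊛-identityʳ z i ⟩
      z i               ∎

  ⊛-nonzero : ∀ {n} (B : Matrix n n) → IsInvertible B →
              ∀ {x} → ¬ (x ≋ 𝟎) → ¬ (x ⊛ B ≋ 𝟎)
  ⊛-nonzero B B-inv x≉𝟎 xB≋𝟎 =
    x≉𝟎 (⊛-injective B B-inv (λ j → trans (xB≋𝟎 j) (sym (𝟎-⊛ B j))))

  ⊛-reflects-∼ : ∀ {n} (B : Matrix n n) → IsInvertible B →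
                 ∀ {x y} → x ⊛ B ∼ y ⊛ B → x ∼ y
  ⊛-reflects-∼ B B-inv {x} (r , r≉0 , yB≋r•xB) =
    r , r≉0 , ⊛-injective B B-inv (λ j → trans (yB≋r•xB j) (sym (•-⊛ r x B j)))

  -- The cross product and orthogonality.

  infixl 7 _×ᵥ_
  _×ᵥ_ : Vector Carrier 3 → Vector Carrier 3 → Vector Carrier 3
  (x ×ᵥ y) 0F = x 1F * y 2F - x 2F * y 1F
  (x ×ᵥ y) 1F = x 2F * y 0F - x 0F * y 2F
  (x ×ᵥ y) 2F = x 0F * y 1F - x 1F * y 0F

  -- Up to sign, the coordinates of the cross product are the off-diagonal minors in `x ∥ y`; `sym`
  -- accounts for the sign.
  ×ᵥ-zero⇒∥ : ∀ {x y} → x ×ᵥ y ≋ 𝟎 → x ∥ y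
  ×ᵥ-zero⇒∥ z≋𝟎 0F 0F = refl
  ×ᵥ-zero⇒∥ z≋𝟎 0F 1F = x∙y⁻¹≈ε⇒x≈y _ _ (z≋𝟎 2F)
  ×ᵥ-zero⇒∥ z≋𝟎 0F 2F = sym (x∙y⁻¹≈ε⇒x≈y _ _ (z≋𝟎 1F))
  ×ᵥ-zero⇒∥ z≋𝟎 1F 0F = sym (x∙y⁻¹≈ε⇒x≈y _ _ (z≋𝟎 2F))
  ×ᵥ-zero⇒∥ z≋𝟎 1F 1F = refl
  ×ᵥ-zero⇒∥ z≋𝟎 1F 2F = x∙y⁻¹≈ε⇒x≈y _ _ (z≋𝟎 0F)
  ×ᵥ-zero⇒∥ z≋𝟎 2F 0F = x∙y⁻¹≈ε⇒x≈y _ _ (z≋𝟎 1F)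
  ×ᵥ-zero⇒∥ z≋𝟎 2F 1F = sym (x∙y⁻¹≈ε⇒x≈y _ _ (z≋𝟎 0F))
  ×ᵥ-zero⇒∥ z≋𝟎 2F 2F = refl

  difference-exchange : ∀ {p q r s a b} → p * a + q * b ≈ r * a + s * b →
                        (p - r) * a ≈ (s - q) * b
  difference-exchange {p} {q} {r} {s} {a} {b} eq = +-cancelʳ (r * a + q * b) _ _ (begin
    -- The solver handles only semiring identities, so `- r` enters as an independent variable and
    -- `vanish` removes `r - r` afterwards.
    (p - r) * a + (r * a + q * b)        ≈⟨ solve 6 (λ p q r r′ a b →
        (p :+ r′) :* a :+ (r :* a :+ q :* b) := (r :+ r′) :* a :+ (p :* a :+ q :* b))
        refl p q r (- r) a b ⟩
    (r - r) * a + (p * a + q * b)        ≈⟨ +-cong (vanish r a) eq ⟩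
    0# + (r * a + s * b)                 ≈⟨ +-congʳ (vanish q b) ⟨
    (q - q) * b + (r * a + s * b)        ≈⟨ solve 6 (λ q q′ r s a b →
        (q :+ q′) :* b :+ (r :* a :+ s :* b) := (s :+ q′) :* b :+ (r :* a :+ q :* b))
        refl q (- q) r s a b ⟩
    (s - q) * b + (r * a + q * b)        ∎)
    where
    vanish : ∀ t u → (t - t) * u ≈ 0#
    vanish t u = trans (*-congʳ (-‿inverseʳ t)) (zeroˡ u)

  -- The k-th coordinate of (x × y) × a = (x · a) y − (y · a) x, for a cyclic
  -- order i, j, k; the sums are spelled out so that they can be rotated.
  orthogonal-minors : ∀ (x y a : Vector Carrier 3) i j k →
    a i * x i + (a j * x j + (a k * x k + 0#)) ≈ 0# →
    a i * y i + (a j * y j + (a k * y k + 0#)) ≈ 0# →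
    (x j * y k - x k * y j) * a j ≈ (x k * y i - x i * y k) * a i
  orthogonal-minors x y a i j k a·x≈0 a·y≈0 =
    -- Adding the common term `x k * y k * a k` completes the two sides to `y k` times `a · x` and
    -- `x k` times `a · y`, both zero.
    difference-exchange (+-cancelʳ (x k * y k * a k) _ _ (begin
      x j * y k * a j + x i * y k * a i + x k * y k * a k
        ≈⟨ factor (a i) (a j) (a k) (x i) (x j) (x k) (y k) ⟩
      y k * (a i * x i + (a j * x j + (a k * x k + 0#)))
        ≈⟨ trans (*-congˡ a·x≈0) (zeroʳ _) ⟩
      0#
        ≈⟨ trans (*-congˡ a·y≈0) (zeroʳ _) ⟨
      x k * (a i * y i + (a j * y j + (a k * y k + 0#)))
        ≈⟨ factor′ (a i) (a j) (a k) (y i) (y j) (y k) (x k) ⟨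
      x k * y j * a j + x k * y i * a i + x k * y k * a k ∎))
    where
    factor : ∀ aᵢ aⱼ aₖ xᵢ xⱼ xₖ t →
      xⱼ * t * aⱼ + xᵢ * t * aᵢ + xₖ * t * aₖ ≈
      t * (aᵢ * xᵢ + (aⱼ * xⱼ + (aₖ * xₖ + 0#)))
    factor = solve 7 (λ aᵢ aⱼ aₖ xᵢ xⱼ xₖ t →
      xⱼ :* t :* aⱼ :+ xᵢ :* t :* aᵢ :+ xₖ :* t :* aₖ :=
      t :* (aᵢ :* xᵢ :+ (aⱼ :* xⱼ :+ (aₖ :* xₖ :+ con 0)))) refl

    factor′ : ∀ aᵢ aⱼ aₖ yᵢ yⱼ yₖ t →
      t * yⱼ * aⱼ + t * yᵢ * aᵢ + t * yₖ * aₖ ≈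
      t * (aᵢ * yᵢ + (aⱼ * yⱼ + (aₖ * yₖ + 0#)))
    factor′ = solve 7 (λ aᵢ aⱼ aₖ yᵢ yⱼ yₖ t →
      t :* yⱼ :* aⱼ :+ t :* yᵢ :* aᵢ :+ t :* yₖ :* aₖ :=
      t :* (aᵢ :* yᵢ :+ (aⱼ :* yⱼ :+ (aₖ :* yₖ :+ con 0)))) refl

  ⊥⇒×ᵥ-∥ : ∀ x y {a} → a · x ≈ 0# → a · y ≈ 0# → x ×ᵥ y ∥ a
  ⊥⇒×ᵥ-∥ x y {a} a·x≈0 a·y≈0 = λ where
      0F 0F → refl
      0F 1F → z₀a₁≈z₁a₀
      0F 2F → sym z₂a₀≈z₀a₂
      1F 0F → sym z₀a₁≈z₁a₀
      1F 1F → refl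
      1F 2F → z₁a₂≈z₂a₁
      2F 0F → z₂a₀≈z₀a₂
      2F 1F → sym z₁a₂≈z₂a₁
      2F 2F → refl
    where
    -- A sum over three indices unfolds in the order 0, 1, 2; the other two cyclic instances of
    -- `orthogonal-minors` need it to start elsewhere.
    rotate : ∀ {r s t} → r + (s + (t + 0#)) ≈ 0# → s + (t + (r + 0#)) ≈ 0#
    rotate {r} {s} {t} = trans (solve 3 (λ r s t →
      s :+ (t :+ (r :+ con 0)) := r :+ (s :+ (t :+ con 0))) refl r s t)

    z = x ×ᵥ y

    z₀a₁≈z₁a₀ : z 0F * a 1F ≈ z 1F * a 0F
    z₀a₁≈z₁a₀ = orthogonal-minors x y a 0F 1F 2F a·x≈0 a·y≈0

    z₁a₂≈z₂a₁ : z 1F * a 2F ≈ z 2F * a 1F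
    z₁a₂≈z₂a₁ = orthogonal-minors x y a 1F 2F 0F (rotate a·x≈0) (rotate a·y≈0)

    z₂a₀≈z₀a₂ : z 2F * a 0F ≈ z 0F * a 2F
    z₂a₀≈z₀a₂ = orthogonal-minors x y a 2F 0F 1F
      (rotate (rotate a·x≈0)) (rotate (rotate a·y≈0))

  -- For a nondegenerate bilinear form on a space of dimension three, a totally isotropic subspace
  -- has dimension at most one. Both mixed products are listed because `B` may be asymmetric here.
  totallyIsotropic⇒∼ : ∀ (B : Matrix 3 3) → IsInvertible B →
    ∀ {x y} → ¬ (x ≋ 𝟎) → ¬ (y ≋ 𝟎) →
    (x ⊛ B) · x ≈ 0# → (x ⊛ B) · y ≈ 0# →
    (y ⊛ B) · x ≈ 0# → (y ⊛ B) · y ≈ 0# → x ∼ y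
  totallyIsotropic⇒∼ B B-inv {x} {y} x≉𝟎 y≉𝟎 xBx≈0 xBy≈0 yBx≈0 yBy≈0
    with all? (λ i → (x ×ᵥ y) i ≈? 0#)
  ... | yes z≋𝟎 = ∥⇒∼ x≉𝟎 y≉𝟎 (×ᵥ-zero⇒∥ z≋𝟎)
  ... | no  z≉𝟎 = ⊛-reflects-∼ B B-inv
    (∥⇒∼ (⊛-nonzero B B-inv x≉𝟎) (⊛-nonzero B B-inv y≉𝟎)
      (∥-common z≉𝟎 (⊥⇒×ᵥ-∥ x y xBx≈0 xBy≈0) (⊥⇒×ᵥ-∥ x y yBx≈0 yBy≈0)))

mainTheorem16 : ∀ {c ℓ g : Level} (q : ℕ) → IsPrimePower q →
    (F : FiniteField q c ℓ) (G : LoopedGraph g) →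
    G ∈ 𝔤 3 F → NonloopedClique G
mainTheorem16 q _ F G (m , x , x-reps , B , B-inv , B-sym , G≅Γ) u v u≢v u-nonlooped v-nonlooped =
  -- Adjacency in `Γ` is the negation `≉ 0#`, so refuting `uv≈0` proves it.
  from (adjacency u v) λ uv≈0 →
    u≢v (Injection.injective (Inverse⇒Injection vertices) (distinct
      (totallyIsotropic⇒∼ B B-inv (nonzero _) (nonzero _)
        (nonlooped⇒isotropic u u-nonlooped) uv≈0
        (trans (congruence-symmetric (fromColumns x) B B-sym (φ u) (φ v)) uv≈0)
        (nonlooped⇒isotropic v v-nonlooped))))
  where
  open FiniteField F using (_≈_; 0#; trans)
  open OverField F
  open LinearAlgebra F
  open LoopedGraph G using (Looped)
  open IsRepresentatives x-reps
  open _≅_ G≅Γ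
  open Equivalence using (from)
  open Inverse vertices using () renaming (to to φ)

  nonlooped⇒isotropic : ∀ w → ¬ Looped w → (x (φ w) ⊛ B) · x (φ w) ≈ 0#
  nonlooped⇒isotropic w w-nonlooped =
    -- Being nonlooped gives only the double negation of the equation; decidable equality in the
    -- finite field removes it.
    decidable-stable (_ ≈? _) (λ ww≉0 → w-nonlooped (from (adjacency w w) ww≉0))
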